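{- Let $\mathcal{G}$ be a game such that for every player $j$ and every history $h\in\mathbf{Hist}_{v_{\mathrm{init}}}(\mathcal{G})$ there exists $\sigma_j\in\Sigma_j$ with $\mathbf{aVal}_j(h,\sigma_j)=\mathbf{aVal}_j(h)$. Let $i$ be a player and $\sigma_i\in\Sigma_i$. Then $\sigma_i$ is admissible if, and only if, for every history $h\in\mathbf{Hist}_{v_{\mathrm{init}}}(\mathcal{G},\sigma_i)$ with $\mathrm{last}(h)\in V_i$, at least one of the following holds: (1) $\mathbf{cVal}_i(h,\sigma_i)>\mathbf{aVal}_i(h)$; (2) $\mathbf{aVal}_i(h,\sigma_i)=\mathbf{cVal}_i(h,\sigma_i)=\mathbf{aVal}_i(h)=\mathbf{acVal}_i(h)$.
   Context: A game is a tuple $\mathcal{G}=\langle P,(V_i)_{i\in P},v_{\mathrm{init}},E,(\mathrm{payoff}_i)_{i\in P}\rangle$ where $P$ is a finite non-empty set of players; $V=\biguplus_{i\in P}V_i$ with each $V_i$ a finite set (the vertices of player $i$); $v_{\mathrm{init}}\in V$ is the initial vertex; $E\subseteq V\times V$ is a set of edges such that every vertex has at least one outgoing edge; and each $\mathrm{payoff}_i$ is a function from infinite paths of the digraph $\langle V,E\rangle$ to $\mathbb{R}$. An outcome is an infinite path $\rho=\rho_1\rho_2\cdots$ in $\langle V,E\rangle$; a history is a non-empty finite prefix $h$ of an outcome, of length $|h|$ and last vertex $\mathrm{last}(h)$; $\rho_{\le k}$ is the prefix of length $k$ of $\rho$. A strategy of player $i$ maps every history $h$ with $\mathrm{last}(h)\in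 V_i$ to a successor of $\mathrm{last}(h)$. $\Sigma_i$ is the set of strategies of player $i$, and $\Sigma_{ -i}$ is the set of tuples of strategies, one for each player other than $i$. For a history (or vertex) $h$ and a profile $(\sigma_i,\sigma_{ -i})$ of strategies of all players, $\mathbf{Out}_h(\sigma_i,\sigma_{ -i})$ is the unique outcome $\rho$ with $\rho_{\le|h|}=h$ such that for all $j\ge|h|$, $\rho_{j+1}$ is the vertex prescribed at $\rho_{\le j}$ by the strategy of the player owning $\rho_j$. $\mathbf{Hist}_{v_{\mathrm{init}}}(\mathcal{G})$ is the set of histories starting at $v_{\mathrm{init}}$, and $\mathbf{Hist}_{v_{\mathrm{init}}}(\mathcal{G},\sigma_i)$ is the set of non-empty finite prefixes of outcomes $\mathbf{Out}_{v_{\mathrm{init}}}(\sigma_i,\sigma_{ -i})$ with $\sigma_{ -i}\in\Sigma_{ -i}$. For a history $h$ and $\sigma_i\in\Sigma_i$: $\mathbf{aVal}_i(h,\sigma_i)=\inf_{\tau\in\Sigma_{ -i}}\mathrm{payoff}_i(\mathbf{Out}_h(\sigma_i,\tau))$; $\mathbf{cVal}_i(h,\sigma_i)=\sup_{\tau\in\Sigma_{ -i}}\mathrm{payoff}_i(\mathbf{Out}_h(\sigma_i,\tau))$; $\mathbf{aVal}_i(h)=\sup_{\sigma_i\in\Sigma_i}\mathbf{aVal}_i(h,\sigma_i)$; $\mathbf{cVal}_i(h)=\sup_{\sigma_i\in\Sigma_i}\mathbf{cVal}_i(h,\sigma_i)$; and $\mathbf{acVal}_i(h)=\sup\{\mathbf{cVal}_i(h,\sigma_i)\mid\sigma_i\in\Sigma_i,\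 \mathbf{aVal}_i(h,\sigma_i)\ge\mathbf{aVal}_i(h)\}$ (with $\sup\emptyset=-\infty$). Suprema and infima are taken in $\mathbb{R}\cup\{\pm\infty\}$. A strategy $\sigma_i$ very weakly dominates $\sigma_i'$ (both in $\Sigma_i$) if $\mathrm{payoff}_i(\mathbf{Out}_{v_{\mathrm{init}}}(\sigma'_i,\sigma_{ -i}))\le\mathrm{payoff}_i(\mathbf{Out}_{v_{\mathrm{init}}}(\sigma_i,\sigma_{ -i}))$ for all $\sigma_{ -i}\in\Sigma_{ -i}$. It weakly dominates $\sigma'_i$ if it very weakly dominates $\sigma_i'$ and $\sigma_i'$ does not very weakly dominate $\sigma_i$. A strategy in $\Sigma_i$ is admissible if no strategy in $\Sigma_i$ weakly dominates it. -}

module Defs where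

open import Data.Fin.Base using (Fin)
import Data.Fin.Properties as Fin
open import Data.Nat.Base using (ℕ; zero; suc; _+_)
open import Data.Nat.Properties using (+-comm; +-suc)
open import Data.Product.Base using (Σ; ∃; _×_; _,_; proj₁; proj₂)
open import Data.Rational.Base using (ℚ; _<_)
open import Data.Rational.Properties using (<-dense; <-trans)
open import Function.Bundles using (_↔_)
open import Function.Properties.Inverse using (↔⇒↣)
open import Level using (0ℓ)
open import Relation.Binary.Core using (Rel)
open import Relation.Binary.Definitions using (DecidableEquality; Irrelevant)
open import Relation.Binary.PropositionalEquality using (_≡_; _≢_; refl; sym; trans; cong)
open import Relation.Nullary using (¬_; yes; no)
open import Relation.Nullary.Decidable using (via-injection)

------------------------------------------------------------------------
-- Real and extended real numbers

-- ℝ ∪ {±∞} as lower Dedekind cuts: an open, downward closed set of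
-- rationals.  The empty cut is −∞ and the full cut is +∞; classically,
-- every other cut is a real number.

record ℝ∞ : Set₁ where
  field
    _∋_    : ℚ → Set
    down   : ∀ {p q} → p < q → _∋_ q → _∋_ p
    open-∋ : ∀ {p} → _∋_ p → ∃ λ q → p < q × _∋_ q

infix 4 _∈ᶜ_ _≤ᶜ_ _≈ᶜ_ _<ᶜ_

_∈ᶜ_ : ℚ → ℝ∞ → Set
q ∈ᶜ x = ℝ∞._∋_ x q

_≤ᶜ_ _≈ᶜ_ _<ᶜ_ : ℝ∞ → ℝ∞ → Set
x ≤ᶜ y = ∀ {q} → q ∈ᶜ x → q ∈ᶜ y
x ≈ᶜ y = x ≤ᶜ y × y ≤ᶜ x
x <ᶜ y = x ≤ᶜ y × ¬ (y ≤ᶜ x)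

record ℝ : Set₁ where
  field
    cut      : ℝ∞
    nonempty : ∃ λ q → q ∈ᶜ cut
    proper   : ∃ λ q → ¬ (q ∈ᶜ cut)

open ℝ public using (cut)

sup : {I : Set} → (I → ℝ∞) → ℝ∞
sup f = record
  { _∋_    = λ q → ∃ λ i → q ∈ᶜ f i
  ; down   = λ { p<q (i , q∈) → i , ℝ∞.down (f i) p<q q∈ }
  ; open-∋ = λ { (i , p∈) → let (q , p<q , q∈) = ℝ∞.open-∋ (f i) p∈
                            in q , p<q , i , q∈ }
  }

-- An intersection of open cuts need not be open, hence the interior.

inf : {I : Set} → (I → ℝ∞) → ℝ∞
inf f = record
  { _∋_    = λ q → ∃ λ r → q < r × (∀ i → r ∈ᶜ f i)
  ; down   = λ { p<q (r , q<r , r∈) → r , <-trans p<q q<r , r∈ }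
  ; open-∋ = λ { (r , p<r , r∈) → let (q , p<q , q<r) = <-dense p<r
                                  in q , p<q , r , q<r , r∈ }
  }

module _ {I : Set} (f : I → ℝ∞) where

  sup-upper : ∀ i → f i ≤ᶜ sup f
  sup-upper i q∈ = i , q∈

  sup-least : ∀ x → (∀ i → f i ≤ᶜ x) → sup f ≤ᶜ x
  sup-least x f≤x (i , q∈) = f≤x i q∈

  inf-lower : ∀ i → inf f ≤ᶜ f i
  inf-lower i (r , q<r , r∈) = ℝ∞.down (f i) q<r (r∈ i)

  inf-greatest : ∀ x → (∀ i → x ≤ᶜ f i) → x ≤ᶜ inf f
  inf-greatest x x≤f q∈ =
    let (r , q<r , r∈) = ℝ∞.open-∋ x q∈ in r , q<r , λ i → x≤f i r∈

------------------------------------------------------------------------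
-- Games

-- Positions are counted from 0.

record InfPath {V : Set} (E : Rel V 0ℓ) : Set where
  field
    at   : ℕ → V
    edge : ∀ k → E (at k) (at (suc k))

open InfPath public

record Game : Set₁ where
  infix 4 _≟ᴾ_
  field
    P        : Set
    P-finite : ∃ λ n → P ↔ Fin (suc n)
    V        : P → Set
    V-finite : ∀ i → ∃ λ n → V i ↔ Fin n

  -- The disjoint union of the V i; the owner of (i , x) is i.
  Vertex : Set
  Vertex = Σ P V

  field
    v-init       : Vertex
    E            : Rel Vertex 0ℓ
    E-irrelevant : Irrelevant E
    E-total      : ∀ v → ∃ λ w → E v w
    payoff       : P → InfPath E → ℝ
    -- Two paths are the same when they visit the same vertices.
    payoff-cong  : ∀ i (ρ ρ′ : InfPath E) → (∀ k → at ρ k ≡ at ρ′ k) →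
                   cut (payoff i ρ) ≈ᶜ cut (payoff i ρ′)

  _≟ᴾ_ : DecidableEquality P
  _≟ᴾ_ = via-injection (↔⇒↣ (proj₂ P-finite)) Fin._≟_

module Play (G : Game) where

  open Game G public

  Outcome : Set
  Outcome = InfPath E

  -- Histories from u with last vertex v.  By E-total, every finite path
  -- is a prefix of an outcome (see Out-⊒).

  infixl 5 _▷_

  data History (u : Vertex) : Vertex → Set where
    start : History u u
    _▷_   : ∀ {v w} → History u v → E v w → History u w

  ∣_∣ : ∀ {u v} → History u v → ℕ
  ∣ start ∣ = 1
  ∣ h ▷ _ ∣ = suc ∣ h ∣

  infix 4 _⊑_

  _⊑_ : ∀ {u v} → History u v → Outcome → Set
  _⊑_ {u}     start   ρ = at ρ 0 ≡ u
  _⊑_ {v = w} (h ▷ _) ρ = h ⊑ ρ × at ρ ∣ h ∣ ≡ w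

  record Strategy (i : P) : Set where
    field
      choose : ∀ {u x} → History u (i , x) → ∃ λ w → E (i , x) w

  Profile : Set
  Profile = ∀ j → Strategy j

  -- Σ₋ᵢ
  CoStrategy : P → Set
  CoStrategy i = ∀ j → .(j ≢ i) → Strategy j

  ⟨_,_⟩ : ∀ {i} → Strategy i → CoStrategy i → Profile
  ⟨_,_⟩ {i} σ τ j with j ≟ᴾ i
  ... | yes refl = σ
  ... | no  j≢i  = τ j j≢i

  module _ (σ : Profile) where

    next : ∀ {u v} → History u v → ∃ λ w → E v w
    next {v = (j , _)} h = Strategy.choose (σ j) h

    -- The history obtained from h after n further moves.
    play : ∀ {u v} → History u v → ℕ → ∃ λ w → History u w
    play h zero    = _ , h
    play h (suc n) = let (_ , g) = play h n in _ , g ▷ proj₂ (next g)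

    continuation : ∀ {u v} → History u v → Outcome
    continuation h = record
      { at   = λ n → proj₁ (play h n)
      ; edge = λ n → proj₂ (next (proj₂ (play h n)))
      }

  cons : ∀ {v} (ρ : Outcome) → E v (at ρ 0) → Outcome
  cons {v} ρ e = record
    { at   = λ { zero → v ; (suc k) → at ρ k }
    ; edge = λ { zero → e ; (suc k) → edge ρ k }
    }

  prepend : ∀ {u v} → History u v → (ρ : Outcome) → at ρ 0 ≡ v → Outcome
  prepend start   ρ _    = ρ
  prepend (h ▷ e) ρ refl = prepend h (cons ρ e) refl

  Out : ∀ {u v} → History u v → Profile → Outcome
  Out h σ = prepend h (continuation σ h) refl

  -- Out h σ extends h and every history that σ produces from h.

  private
    edges : ∀ {u v} → History u v → ℕ
    edges start   = 0
    edges (h ▷ _) = suc (edges h)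

    ∣∣-edges : ∀ {u v} (h : History u v) → ∣ h ∣ ≡ suc (edges h)
    ∣∣-edges start   = refl
    ∣∣-edges (h ▷ _) = cong suc (∣∣-edges h)

    prepend-at : ∀ {u v} (h : History u v) ρ eq k →
                 at (prepend h ρ eq) (edges h + k) ≡ at ρ k
    prepend-at start   ρ _    k = refl
    prepend-at (h ▷ e) ρ refl k = trans
      (cong (at (prepend h (cons ρ e) refl)) (sym (+-suc (edges h) k)))
      (prepend-at h (cons ρ e) refl (suc k))

    prepend-length : ∀ {u v} (h : History u v) ρ eq →
                     at (prepend h ρ eq) ∣ h ∣ ≡ at ρ 1
    prepend-length h ρ eq = trans
      (cong (at (prepend h ρ eq)) (trans (∣∣-edges h) (+-comm 1 (edges h))))
      (prepend-at h ρ eq 1)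

    prepend-⊒ : ∀ {u v} (h : History u v) ρ eq → h ⊑ prepend h ρ eq
    prepend-⊒ start   ρ eq   = eq
    prepend-⊒ (h ▷ e) ρ refl =
      prepend-⊒ h (cons ρ e) refl , prepend-length h (cons ρ e) refl

    ∣play∣ : ∀ σ {u v} (h : History u v) n →
             ∣ proj₂ (play σ h n) ∣ ≡ edges h + suc n
    ∣play∣ σ h zero    = trans (∣∣-edges h) (+-comm 1 (edges h))
    ∣play∣ σ h (suc n) =
      trans (cong suc (∣play∣ σ h n)) (sym (+-suc (edges h) (suc n)))

  Out-⊒ : ∀ {u v} (h : History u v) σ n → proj₂ (play σ h n) ⊑ Out h σ
  Out-⊒ h σ zero    = prepend-⊒ h (continuation σ h) refl
  Out-⊒ h σ (suc n) = Out-⊒ h σ n , trans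
    (cong (at (Out h σ)) (∣play∣ σ h n))
    (prepend-at h (continuation σ h) refl (suc n))

  -- A history of Hist(𝒢, σ) starts at v-init, as h ⊑ Out start _ with
  -- h : History v-init v.

  infix 4 _∈Hist_

  _∈Hist_ : ∀ {v i} → History v-init v → Strategy i → Set
  h ∈Hist σ = ∃ λ τ → h ⊑ Out {v-init} start ⟨ σ , τ ⟩

  payoffOut : ∀ {i u v} → History u v → Strategy i → CoStrategy i → ℝ∞
  payoffOut {i} h σ τ = cut (payoff i (Out h ⟨ σ , τ ⟩))

  -- Subscript ₛ: the value of a strategy; otherwise of a history.

  aValₛ cValₛ : ∀ {i u v} → History u v → Strategy i → ℝ∞
  aValₛ h σ = inf (payoffOut h σ)
  cValₛ h σ = sup (payoffOut h σ)

  aVal acVal : ∀ {u v} → P → History u v → ℝ∞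
  aVal  i h = sup {Strategy i} (aValₛ h)
  acVal i h = sup {∃ λ (σ : Strategy i) → aVal i h ≤ᶜ aValₛ h σ}
                  (λ (σ , _) → cValₛ h σ)

  VeryWeaklyDominates WeaklyDominates : ∀ {i} → Rel (Strategy i) 0ℓ
  VeryWeaklyDominates σ σ′ =
    ∀ τ → payoffOut {u = v-init} start σ′ τ ≤ᶜ payoffOut {u = v-init} start σ τ
  WeaklyDominates σ σ′ =
    VeryWeaklyDominates σ σ′ × ¬ VeryWeaklyDominates σ′ σ

  Admissible : ∀ {i} → Strategy i → Set
  Admissible σ = ∀ σ′ → ¬ WeaklyDominates σ′ σ

{-# OPTIONS --safe #-}
module Submission where

open import Defs
open import Axiom.ExcludedMiddle using (ExcludedMiddle)
open import Axiom.UniquenessOfIdentityProofs using (module Decidable⇒UIP)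
open import Data.Bool.Base using (if_then_else_)
open import Data.Nat.Base as ℕ using (zero; suc; s≤s; z≤n)
import Data.Nat.Properties as ℕ
open import Data.Product.Base using (∃; _×_; _,_; proj₁; proj₂)
open import Data.Rational.Properties using (<-cmp)
open import Data.Sum.Base using (_⊎_; inj₁; inj₂)
open import Function.Base using (_∘_)
open import Function.Bundles using (_⇔_; mk⇔)
open import Level using (0ℓ)
open import Relation.Binary.Definitions using (tri<; tri≈; tri>)
open import Relation.Binary.PropositionalEquality
  using (_≡_; _≢_; refl; sym; trans; cong)
open import Relation.Nullary using (¬_; yes; no; does; contradiction)
open import Relation.Nullary.Decidable using (decidable-stable)

-- Everything is reduced to splicing strategies at a history h.
-- If σ violates (1) at h, then replacing σ after h by a strategy which is
-- worst-case optimal at h yields a strategy that very weakly dominates σ;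
-- admissibility then forces σ to be at least as good as every worst-case
-- optimal strategy after h, which is (2).
-- Conversely, let σ′ very weakly dominate σ and let h be a history where σ and
-- σ′ first choose different successors.  As the opponents may answer the two
-- choices independently, every payoff of σ after h is at most every payoff of
-- σ′ after h, so (1) fails at h; and under (2) the strategy σ′ is worst-case
-- optimal at h, hence cannot exceed the constant payoff of σ there.

-- A rational of `y` missing from `x` bounds `x` from above, as cuts are downward closed.
≰ᶜ⇒≥ᶜ : ExcludedMiddle 0ℓ → ∀ x y → ¬ (x ≤ᶜ y) → y ≤ᶜ x
≰ᶜ⇒≥ᶜ em x y x≰y {q} q∈y = decidable-stable em λ q∉x →
  x≰y (below q∉x)
  where
  below : ¬ (q ∈ᶜ x) → x ≤ᶜ y
  below q∉x {p} p∈x with <-cmp p q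
  ... | tri< p<q _ _  = ℝ∞.down y p<q q∈y
  ... | tri≈ _ refl _ = q∈y
  ... | tri> _ _ q<p  = contradiction (ℝ∞.down x q<p p∈x) q∉x

-- Prefix order on histories, and outcomes that follow a profile.

module Outcomes (G : Game) where

  open Play G

  infix 4 _≼_

  -- The second history may start at any vertex, since a spliced strategy has to choose at those
  -- histories too.
  data _≼_ {u v} (h : History u v) : ∀ {u′ w} → History u′ w → Set where
    here  : h ≼ h
    later : ∀ {u′ w w′} {g : History u′ w} {e : E w w′} → h ≼ g → h ≼ g ▷ e

  ▷-≼⇒≼ : ∀ {u v w u′ w′} {h : History u v} {e : E v w} {g : History u′ w′} →
          h ▷ e ≼ g → h ≼ g
  ▷-≼⇒≼ here      = later here
  ▷-≼⇒≼ (later p) = later (▷-≼⇒≼ p)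

  start-≼ : ∀ {u v} (h : History u v) → start {u} ≼ h
  start-≼ start   = here
  start-≼ (h ▷ _) = later (start-≼ h)

  ≼-trans : ∀ {u v u′ v′ u″ v″}
            {f : History u v} {g : History u′ v′} {h : History u″ v″} →
            f ≼ g → g ≼ h → f ≼ h
  ≼-trans p here      = p
  ≼-trans p (later q) = later (≼-trans p q)

  ≼-⊑ : ∀ {u v u′ w} {h : History u v} {g : History u′ w} {ρ} →
        h ≼ g → g ⊑ ρ → h ⊑ ρ
  ≼-⊑ here      g⊑ρ       = g⊑ρ
  ≼-⊑ (later p) (g⊑ρ , _) = ≼-⊑ p g⊑ρ

  ≼⇒∣∣≤ : ∀ {u v u′ w} {h : History u v} {g : History u′ w} →
          h ≼ g → ∣ h ∣ ℕ.≤ ∣ g ∣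
  ≼⇒∣∣≤ here      = ℕ.≤-refl
  ≼⇒∣∣≤ (later p) = ℕ.m≤n⇒m≤1+n (≼⇒∣∣≤ p)

  ▷-⋠ : ∀ {u v w} {h : History u v} {e : E v w} → ¬ (h ▷ e ≼ h)
  ▷-⋠ p = ℕ.<-irrefl refl (≼⇒∣∣≤ p)

  ⊑-agree : ∀ {u v} (h : History u v) {ρ ρ′} → h ⊑ ρ → h ⊑ ρ′ →
            ∀ {k} → k ℕ.< ∣ h ∣ → at ρ k ≡ at ρ′ k
  ⊑-agree start   eq eq′ (s≤s z≤n) = trans eq (sym eq′)
  ⊑-agree (h ▷ _) (h⊑ρ , eq) (h⊑ρ′ , eq′) k<1+∣h∣
    with ℕ.m<1+n⇒m<n∨m≡n k<1+∣h∣
  ... | inj₁ k<∣h∣ = ⊑-agree h h⊑ρ h⊑ρ′ k<∣h∣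
  ... | inj₂ refl  = trans eq (sym eq′)

  edge-≡ : ∀ {v} {x y : ∃ λ w → E v w} → proj₁ x ≡ proj₁ y → x ≡ y
  edge-≡ {x = w , _} refl = cong (w ,_) (E-irrelevant _ _)

  -- ρ is the outcome of π from h, up to pointwise equality (see
  -- Conforms-unique).

  Conforms : ∀ {u v} → Profile → History u v → Outcome → Set
  Conforms {u} π h ρ = h ⊑ ρ ×
    (∀ {w} {g : History u w} → h ≼ g → g ⊑ ρ → at ρ ∣ g ∣ ≡ proj₁ (next π g))

  -- `_⊑_` constrains vertices only; irrelevance of edges recovers the history itself.
  Out-play : ∀ π {u v w} {h : History u v} {g : History u w} →
             h ≼ g → g ⊑ Out h π → ∃ λ n → play π h n ≡ (w , g)
  Out-play π here _ = 0 , refl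
  Out-play π {h = h} (later p) (g⊑ρ , eq) with Out-play π p g⊑ρ
  ... | n , refl = suc n , cong (λ (w , e) → w , proj₂ (play π h n) ▷ e)
                                (edge-≡ (trans (sym (proj₂ (Out-⊒ h π (suc n)))) eq))

  Out-conforms : ∀ π {u v} (h : History u v) → Conforms π h (Out h π)
  Out-conforms π h = Out-⊒ h π 0 , follows
    where
    follows : ∀ {w} {g : History _ w} → h ≼ g → g ⊑ Out h π →
              at (Out h π) ∣ g ∣ ≡ proj₁ (next π g)
    follows p g⊑ρ with Out-play π p g⊑ρ
    ... | n , refl = proj₂ (Out-⊒ h π (suc n))

  Conforms-≼ : ∀ π {u v w} {h : History u v} {g : History u w} {ρ} →
               Conforms π h ρ → h ≼ g → g ⊑ ρ → Conforms π g ρ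
  Conforms-≼ _ (_ , follows) h≼g g⊑ρ =
    g⊑ρ , λ g≼f → follows (≼-trans h≼g g≼f)

  -- Both paths are built up together: a common prefix is extended by the edge that both profiles
  -- choose there. So agreement is asked for on common prefixes only.
  Conforms-unique : ∀ π π′ {u v} {h : History u v} {ρ ρ′} →
    Conforms π h ρ → Conforms π′ h ρ′ →
    (∀ {w} {g : History u w} → h ≼ g → g ⊑ ρ → g ⊑ ρ′ →
       next π g ≡ next π′ g) →
    ∀ k → at ρ k ≡ at ρ′ k
  Conforms-unique π π′ {u} {h = h} {ρ} {ρ′}
    (h⊑ρ , follows) (h⊑ρ′ , follows′) same k =
    let (_ , g , _ , g⊑ρ , g⊑ρ′ , k<∣g∣) = common k
    in ⊑-agree g g⊑ρ g⊑ρ′ k<∣g∣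
    where
    common : ∀ n → ∃ λ w → ∃ λ (g : History u w) →
             h ≼ g × g ⊑ ρ × g ⊑ ρ′ × n ℕ.< ∣ g ∣
    common zero    = _ , h , here , h⊑ρ , h⊑ρ′ , positive h
      where
      positive : ∀ {u v} (h : History u v) → 0 ℕ.< ∣ h ∣
      positive start   = s≤s z≤n
      positive (_ ▷ _) = s≤s z≤n
    common (suc n) =
      let (_ , g , h≼g , g⊑ρ , g⊑ρ′ , n<∣g∣) = common n
      in _ , g ▷ proj₂ (next π g) , later h≼g
       , (g⊑ρ , follows h≼g g⊑ρ)
       , (g⊑ρ′ , trans (follows′ h≼g g⊑ρ′)
                       (cong proj₁ (sym (same h≼g g⊑ρ g⊑ρ′))))
       , s≤s n<∣g∣

  -- Whether `h` is reached depends only on the choices at proper prefixes of `h`, and none of these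
  -- extends `h`.
  ⊑-transfer : ∀ π π′ {u v} (h : History u v) {ρ ρ′} →
    Conforms π (start {u}) ρ → Conforms π′ (start {u}) ρ′ →
    (∀ {w} {g : History u w} → ¬ (h ≼ g) → next π g ≡ next π′ g) →
    h ⊑ ρ → h ⊑ ρ′
  ⊑-transfer _ _ start   _ (start⊑ρ′ , _) _ _ = start⊑ρ′
  ⊑-transfer π π′ (h ▷ e) c@(_ , follows) c′@(_ , follows′) same (h⊑ρ , eq) =
    let h⊑ρ′ = ⊑-transfer π π′ h c c′ (λ h⋠g → same (h⋠g ∘ ▷-≼⇒≼)) h⊑ρ
    in h⊑ρ′ , trans (follows′ (start-≼ h) h⊑ρ′)
             (trans (cong proj₁ (sym (same ▷-⋠)))
             (trans (sym (follows (start-≼ h) h⊑ρ)) eq))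

  -- Agreement of strategies on a set of histories.

  Agree : ∀ {i u} → (∀ {v} → History u v → Set) → Strategy i → Strategy i → Set
  Agree {i} {u} Q σ σ′ = ∀ {x} {g : History u (i , x)} → Q g →
    Strategy.choose σ g ≡ Strategy.choose σ′ g

  CoAgree : ∀ {i u} → (∀ {v} → History u v → Set) → CoStrategy i → CoStrategy i → Set
  CoAgree {i} Q τ τ′ = ∀ j .(j≢i : j ≢ i) → Agree Q (τ j j≢i) (τ′ j j≢i)

  next-agree : ∀ {i u} (Q : ∀ {v} → History u v → Set)
    {σ σ′ : Strategy i} {τ τ′ : CoStrategy i} → Agree Q σ σ′ → CoAgree Q τ τ′ →
    ∀ {w} {g : History u w} → Q g → next ⟨ σ , τ ⟩ g ≡ next ⟨ σ′ , τ′ ⟩ g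
  next-agree {i} Q σ≈σ′ τ≈τ′ {j , _} Qg with j ≟ᴾ i
  ... | yes refl = σ≈σ′ Qg
  ... | no  j≢i  = τ≈τ′ j j≢i Qg

  next-own : ∀ {i} (σ : Strategy i) τ {u x} (h : History u (i , x)) →
             next ⟨ σ , τ ⟩ h ≡ Strategy.choose σ h
  next-own {i} σ τ h with i ≟ᴾ i
  ... | no  i≢i = contradiction refl i≢i
  ... | yes p with Decidable⇒UIP.≡-irrelevant _≟ᴾ_ p refl
  ... | refl = refl

  -- All comparisons of payoffs rest on this. `Q` has to contain only the common prefixes extending
  -- `h`, so it may refer to the two outcomes themselves.
  payoff-agree : ∀ {i u v} (Q : ∀ {w} → History u w → Set)
    {σ σ′ : Strategy i} {τ τ′ : CoStrategy i} {h : History u v} {ρ ρ′} →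
    Agree Q σ σ′ → CoAgree Q τ τ′ →
    Conforms ⟨ σ , τ ⟩ h ρ → Conforms ⟨ σ′ , τ′ ⟩ h ρ′ →
    (∀ {w} {g : History u w} → h ≼ g → g ⊑ ρ → g ⊑ ρ′ → Q g) →
    cut (payoff i ρ) ≈ᶜ cut (payoff i ρ′)
  payoff-agree {i} Q {σ} {σ′} {τ} {τ′} σ≈ τ≈ c c′ toQ = payoff-cong i _ _
    (Conforms-unique ⟨ σ , τ ⟩ ⟨ σ′ , τ′ ⟩ c c′ λ p q r →
      next-agree Q {σ} {σ′} {τ} {τ′} σ≈ τ≈ (toQ p q r))

-- Splicing strategies at a history.

module Splicing (em : ExcludedMiddle 0ℓ) (G : Game) where

  open Play G
  open Outcomes G

  splice : ∀ {i u v} → History u v → Strategy i → Strategy i → Strategy i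
  splice h σ σ′ = record
    { choose = λ g → if does (em {h ≼ g})
                     then Strategy.choose σ g else Strategy.choose σ′ g }

  splice-≼ : ∀ {i u v u′} (h : History u v) (σ σ′ : Strategy i) →
             Agree {u = u′} (h ≼_) (splice h σ σ′) σ
  splice-≼ h σ σ′ {g = g} p with em {h ≼ g}
  ... | yes _  = refl
  ... | no h⋠g = contradiction p h⋠g

  splice-⋠ : ∀ {i u v u′} (h : History u v) (σ σ′ : Strategy i) →
             Agree {u = u′} (λ g → ¬ (h ≼ g)) (splice h σ σ′) σ′
  splice-⋠ h σ σ′ {g = g} h⋠g with em {h ≼ g}
  ... | yes p = contradiction p h⋠g
  ... | no _  = refl

  coSplice : ∀ {i u v} → History u v → CoStrategy i → CoStrategy i → CoStrategy i
  coSplice h τ τ′ j j≢i = splice h (τ j j≢i) (τ′ j j≢i)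

  module _ {i : P} where

    outcome : Strategy i → CoStrategy i → Outcome
    outcome σ τ = Out {v-init} start ⟨ σ , τ ⟩

    outcome-conforms : ∀ σ τ {v} {h : History v-init v} → h ⊑ outcome σ τ →
                       Conforms ⟨ σ , τ ⟩ h (outcome σ τ)
    outcome-conforms σ τ {h = h} =
      Conforms-≼ ⟨ σ , τ ⟩ (Out-conforms ⟨ σ , τ ⟩ start) (start-≼ h)

    payoff-≼ : ∀ {σ σ′ τ τ′ v} {h : History v-init v} →
      Agree (h ≼_) σ σ′ → CoAgree (h ≼_) τ τ′ → h ⊑ outcome σ τ →
      payoffOut {u = v-init} start σ τ ≈ᶜ payoffOut h σ′ τ′
    payoff-≼ {σ} {σ′} {τ} {τ′} {h = h} σ≈ τ≈ h⊑ =
      payoff-agree (h ≼_) σ≈ τ≈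
        (outcome-conforms σ τ h⊑) (Out-conforms ⟨ σ′ , τ′ ⟩ h) (λ p _ _ → p)

    payoff-⊑ : ∀ {σ τ v} {h : History v-init v} → h ⊑ outcome σ τ →
      payoffOut {u = v-init} start σ τ ≈ᶜ payoffOut h σ τ
    payoff-⊑ = payoff-≼ (λ _ → refl) (λ _ _ _ → refl)

    outcome-transfer : ∀ {σ σ′ τ τ′ v} {h : History v-init v} →
      Agree (λ g → ¬ (h ≼ g)) σ σ′ → CoAgree (λ g → ¬ (h ≼ g)) τ τ′ →
      h ⊑ outcome σ τ → h ⊑ outcome σ′ τ′
    outcome-transfer {σ} {σ′} {τ} {τ′} {h = h} σ≈ τ≈ =
      ⊑-transfer ⟨ σ , τ ⟩ ⟨ σ′ , τ′ ⟩ h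
        (Out-conforms ⟨ σ , τ ⟩ start) (Out-conforms ⟨ σ′ , τ′ ⟩ start)
        (next-agree (λ g → ¬ (h ≼ g)) {σ} {σ′} {τ} {τ′} σ≈ τ≈)

    -- If `σ` against `τ` misses `h`, the splice produces the same path; otherwise it also reaches
    -- `h` and plays `σ′` from there on.
    splice-dominates : ∀ (σ σ′ : Strategy i) {v} (h : History v-init v) →
      (∀ τ → payoffOut h σ τ ≤ᶜ payoffOut h σ′ τ) →
      VeryWeaklyDominates (splice h σ′ σ) σ
    splice-dominates σ σ′ h better τ with em {h ⊑ outcome σ τ}
    ... | no h⋢ = proj₁ (payoff-agree (λ g → ¬ (h ≼ g))
          (sym ∘ splice-⋠ h σ′ σ) (λ _ _ _ → refl)
          (Out-conforms ⟨ σ , τ ⟩ start) (Out-conforms ⟨ splice h σ′ σ , τ ⟩ start)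
          (λ _ g⊑ _ h≼g → h⋢ (≼-⊑ h≼g g⊑)))
    ... | yes h⊑ = λ q∈ →
      proj₂ (payoff-≼ (splice-≼ h σ′ σ) (λ _ _ _ → refl)
              (outcome-transfer (sym ∘ splice-⋠ h σ′ σ) (λ _ _ _ → refl) h⊑))
      (better τ (proj₁ (payoff-⊑ h⊑) q∈))

    -- Consequences of dominance at a history reached by both strategies.

    module _ {σ σ′ : Strategy i} (σ′≥σ : VeryWeaklyDominates σ′ σ)
             {τ₀ : CoStrategy i} where

      -- Dominance speaks of play from `v-init` only; opponents who follow `τ₀` up to `h` and `τ`
      -- afterwards carry it over to `h`.
      dominates-at : ∀ {v} (h : History v-init v) →
        h ⊑ outcome σ τ₀ → h ⊑ outcome σ′ τ₀ →
        ∀ τ → payoffOut h σ τ ≤ᶜ payoffOut h σ′ τ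
      dominates-at h h⊑ h⊑′ τ q∈ =
        proj₁ (after h⊑′) (σ′≥σ τ₁ (proj₂ (after h⊑) q∈))
        where
        τ₁ : CoStrategy i
        τ₁ = coSplice h τ τ₀

        after : ∀ {σ} → h ⊑ outcome σ τ₀ →
                payoffOut {u = v-init} start σ τ₁ ≈ᶜ payoffOut h σ τ
        after h⊑ = payoff-≼ (λ _ → refl) (λ j ne → splice-≼ h (τ j ne) (τ₀ j ne))
          (outcome-transfer (λ _ → refl)
            (λ j ne h⋠g → sym (splice-⋠ h (τ j ne) (τ₀ j ne) h⋠g)) h⊑)

      dominates-apart : ∀ {x} (h : History v-init (i , x)) →
        h ⊑ outcome σ τ₀ → h ⊑ outcome σ′ τ₀ →
        Strategy.choose σ h ≢ Strategy.choose σ′ h →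
        ∀ τ τ′ → payoffOut h σ τ ≤ᶜ payoffOut h σ′ τ′
      dominates-apart h h⊑ h⊑′ apart τ τ′ q∈ =
        proj₁ after′ (σ′≥σ τ₁ (proj₂ after q∈))
        where
        h⁺ : History v-init (proj₁ (Strategy.choose σ h))
        h⁺ = h ▷ proj₂ (Strategy.choose σ h)

        -- The opponents play `τ` in the subtree that `σ` enters, `τ′` in the rest of the subtree at
        -- `h`, and `τ₀` elsewhere. Thus after `h` the strategy `σ` meets `τ`, while `σ′` meets
        -- `τ′`.
        τ₁ : CoStrategy i
        τ₁ = coSplice h⁺ τ (coSplice h τ′ τ₀)

        τ₁-⋠ : CoAgree {u = v-init} (λ g → ¬ (h⁺ ≼ g)) τ₁ (coSplice h τ′ τ₀)
        τ₁-⋠ j ne = splice-⋠ h⁺ (τ j ne) (coSplice h τ′ τ₀ j ne)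

        reach : ∀ {σ} → h ⊑ outcome σ τ₀ → h ⊑ outcome σ τ₁
        reach = outcome-transfer (λ _ → refl) λ j ne h⋠g → sym
          (trans (τ₁-⋠ j ne (h⋠g ∘ ▷-≼⇒≼)) (splice-⋠ h (τ′ j ne) (τ₀ j ne) h⋠g))

        turn : ∀ {σ₁ τ₂ ρ} → Conforms ⟨ σ₁ , τ₂ ⟩ h ρ →
               at ρ ∣ h ∣ ≡ proj₁ (Strategy.choose σ₁ h)
        turn {σ₁} {τ₂} (h⊑ρ , follows) =
          trans (follows here h⊑ρ) (cong proj₁ (next-own σ₁ τ₂ h))

        -- Player `i` owns `h`, so every outcome of `σ` from `h` passes through `h⁺`.
        narrow : ∀ {τ₂ ρ} → Conforms ⟨ σ , τ₂ ⟩ h ρ → Conforms ⟨ σ , τ₂ ⟩ h⁺ ρ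
        narrow {τ₂} c = Conforms-≼ ⟨ σ , τ₂ ⟩ c (later here) (proj₁ c , turn c)

        after : payoffOut {u = v-init} start σ τ₁ ≈ᶜ payoffOut h σ τ
        after = payoff-agree (h⁺ ≼_) (λ _ → refl)
          (λ j ne → splice-≼ h⁺ (τ j ne) (coSplice h τ′ τ₀ j ne))
          (narrow (outcome-conforms σ τ₁ (reach h⊑)))
          (narrow (Out-conforms ⟨ σ , τ ⟩ h)) (λ p _ _ → p)

        after′ : payoffOut {u = v-init} start σ′ τ₁ ≈ᶜ payoffOut h σ′ τ′
        after′ = payoff-agree (λ g → h ≼ g × ¬ (h⁺ ≼ g)) (λ _ → refl)
          (λ j ne (h≼g , h⁺⋠g) →
            trans (τ₁-⋠ j ne h⁺⋠g) (splice-≼ h (τ′ j ne) (τ₀ j ne) h≼g))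
          (outcome-conforms σ′ τ₁ (reach h⊑′)) c′
          -- A prefix extending `h⁺` would mean that `σ′` moves at `h` to the vertex chosen by `σ`.
          (λ h≼g _ g⊑ → h≼g , λ h⁺≼g →
            apart (edge-≡ (trans (sym (proj₂ (≼-⊑ h⁺≼g g⊑))) (turn c′))))
          where
          c′ : Conforms ⟨ σ′ , τ′ ⟩ h (Out h ⟨ σ′ , τ′ ⟩)
          c′ = Out-conforms ⟨ σ′ , τ′ ⟩ h

    -- If the choices coincide on all common prefixes, so do the outcomes. A common prefix with
    -- different choices is automatically the first difference, so no minimal one has to be sought.
    agree-or-apart : ∀ (σ σ′ : Strategy i) τ →
      payoffOut {u = v-init} start σ τ ≈ᶜ payoffOut {u = v-init} start σ′ τ ⊎
      (∃ λ x → ∃ λ (h : History v-init (i , x)) →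
        h ⊑ outcome σ τ × h ⊑ outcome σ′ τ ×
        Strategy.choose σ h ≢ Strategy.choose σ′ h)
    agree-or-apart σ σ′ τ
      with em {∃ λ x → ∃ λ (h : History v-init (i , x)) →
               h ⊑ outcome σ τ × h ⊑ outcome σ′ τ ×
               Strategy.choose σ h ≢ Strategy.choose σ′ h}
    ... | yes apart = inj₂ apart
    ... | no ¬apart = inj₁ (payoff-agree
          (λ g → g ⊑ outcome σ τ × g ⊑ outcome σ′ τ)
          (λ (g⊑ , g⊑′) → decidable-stable em λ ne →
            ¬apart (_ , _ , g⊑ , g⊑′ , ne))
          (λ _ _ _ → refl)
          (Out-conforms ⟨ σ , τ ⟩ start) (Out-conforms ⟨ σ′ , τ ⟩ start)
          (λ _ g⊑ g⊑′ → g⊑ , g⊑′))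

theorem12 : ExcludedMiddle 0ℓ →
    (G : Game) → let open Play G in
    (∀ j {v} (h : History v-init v) →
    ∃ λ (σ : Strategy j) → aValₛ h σ ≈ᶜ aVal j h) →
    ∀ i (σ : Strategy i) →
    Admissible σ ⇔
    (∀ {x} (h : History v-init (i , x)) → h ∈Hist σ →
    (aVal i h <ᶜ cValₛ h σ) ⊎
    (aValₛ h σ ≈ᶜ cValₛ h σ × cValₛ h σ ≈ᶜ aVal i h × aVal i h ≈ᶜ acVal i h))
theorem12 em G optimal i σ = mk⇔ necessary sufficient
  where
  open Play G
  open Outcomes G
  open Splicing em G

  -- Necessity of the condition.

  necessary : Admissible σ → ∀ {x} (h : History v-init (i , x)) → h ∈Hist σ →
    (aVal i h <ᶜ cValₛ h σ) ⊎
    (aValₛ h σ ≈ᶜ cValₛ h σ × cValₛ h σ ≈ᶜ aVal i h × aVal i h ≈ᶜ acVal i h)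
  necessary admissible h (τ₀ , h⊑) with em {cValₛ h σ ≤ᶜ aVal i h}
  ... | no c≰a  = inj₁ (≰ᶜ⇒≥ᶜ em (cValₛ h σ) (aVal i h) c≰a , c≰a)
  ... | yes c≤a =
    -- `τ₀` shows that the opponents have a strategy at all, which puts the infimum below the
    -- supremum.
    inj₂ ( ((λ q∈ → τ₀ , inf-lower (payoffOut h σ) τ₀ q∈) , (λ q∈ → a≤aσ (c≤a q∈)))
         , (c≤a , (λ q∈ → τ₀ , inf-lower (payoffOut h σ) τ₀ (a≤aσ q∈)))
         -- By `a≤aσ` the strategy `σ` itself takes part in the supremum `acVal i h`; `worse` bounds
         -- all other participants by it.
         , ((λ q∈ → (σ , a≤aσ) , τ₀ , inf-lower (payoffOut h σ) τ₀ (a≤aσ q∈))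
           , λ ((σ′ , a≤aσ′) , τ , q∈) → c≤a (τ , worse σ′ a≤aσ′ τ q∈)))
    where
    -- By `c≤a`, whatever `σ` can get after `h` is at most what `σ′` guarantees, so the splice very
    -- weakly dominates `σ`. Admissibility reverses this, and the reversed dominance is read off at
    -- `h`.
    worse : ∀ σ′ → aVal i h ≤ᶜ aValₛ h σ′ →
            ∀ τ → payoffOut h σ′ τ ≤ᶜ payoffOut h σ τ
    worse σ′ a≤aσ′ τ q∈ =
      dominates-at σ≥σ″ h h⊑″ h⊑ τ
        (proj₁ (payoff-agree (h ≼_) (sym ∘ splice-≼ h σ′ σ) (λ _ _ _ → refl)
          (Out-conforms _ h) (Out-conforms _ h) (λ p _ _ → p)) q∈)
      where
      σ″ : Strategy i
      σ″ = splice h σ′ σ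

      h⊑″ : h ⊑ outcome σ″ τ₀
      h⊑″ = outcome-transfer (sym ∘ splice-⋠ h σ′ σ) (λ _ _ _ → refl) h⊑

      σ″≥σ : VeryWeaklyDominates σ″ σ
      σ″≥σ = splice-dominates σ σ′ h λ τ q∈ →
        inf-lower (payoffOut h σ′) τ (a≤aσ′ (c≤a (τ , q∈)))

      σ≥σ″ : VeryWeaklyDominates σ σ″
      σ≥σ″ = decidable-stable em λ σ≱σ″ → admissible σ″ (σ″≥σ , σ≱σ″)

    -- Attainment of `aVal i h` enters here: `worse` needs an actual worst-case optimal strategy to
    -- compare with.
    a≤aσ : aVal i h ≤ᶜ aValₛ h σ
    a≤aσ = let (σ′ , _ , a≤aσ′) = optimal i h in
      inf-greatest (payoffOut h σ) (aVal i h) λ τ q∈ →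
        worse σ′ a≤aσ′ τ (inf-lower (payoffOut h σ′) τ (a≤aσ′ q∈))

  -- Sufficiency of the condition.

  sufficient : (∀ {x} (h : History v-init (i , x)) → h ∈Hist σ →
    (aVal i h <ᶜ cValₛ h σ) ⊎
    (aValₛ h σ ≈ᶜ cValₛ h σ × cValₛ h σ ≈ᶜ aVal i h × aVal i h ≈ᶜ acVal i h)) →
    Admissible σ
  sufficient condition σ′ (σ′≥σ , σ≱σ′) = σ≱σ′ below
    where
    below : VeryWeaklyDominates σ σ′
    below τ with agree-or-apart σ σ′ τ
    ... | inj₁ (_ , ≥) = ≥
    ... | inj₂ (_ , h , h⊑ , h⊑′ , apart) with condition h (τ , h⊑)
    -- Each payoff of `σ` after `h` is at most every payoff of `σ′`, hence at most `aValₛ h σ′` and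
    -- so at most `aVal i h`.
    ...   | inj₁ (_ , c≰a) = contradiction
              (λ {q} → sup-least (payoffOut h σ) (aVal i h) (λ τ₁ q∈ → σ′ ,
                inf-greatest (payoffOut h σ′) (payoffOut h σ τ₁)
                  (dominates-apart σ′≥σ h h⊑ h⊑′ apart τ₁) q∈) {q})
              c≰a
    -- `σ′` takes part in the supremum `acVal i h`, so its payoff is at most `aVal i h`, which `σ`
    -- secures against every opponent.
    ...   | inj₂ ((_ , cσ≤aσ) , (_ , a≤cσ) , (_ , ac≤a)) = λ q∈ →
              proj₂ (payoff-⊑ h⊑)
                (a≤σ τ (ac≤a ((σ′ , a≤aσ′) , τ , proj₁ (payoff-⊑ h⊑′) q∈)))
      where
      a≤σ : ∀ τ → aVal i h ≤ᶜ payoffOut h σ τ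
      a≤σ τ q∈ = inf-lower (payoffOut h σ) τ (cσ≤aσ (a≤cσ q∈))

      a≤aσ′ : aVal i h ≤ᶜ aValₛ h σ′
      a≤aσ′ = inf-greatest (payoffOut h σ′) (aVal i h) λ τ₁ q∈ →
        dominates-at σ′≥σ h h⊑ h⊑′ τ₁ (a≤σ τ₁ q∈)
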